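{- (Semimagic) The quad codes of length 16 containing $C_s$ have dimensions between 7 and 11, and the number of them of dimension $7,8,9,10,11$ is $1,159,2531,2823,112$ respectively. (Magic) The quad codes of length 16 containing $C_m$ have dimensions between 8 and 11, and the number of them of dimension $8,9,10,11$ is $1,43,85,10$ respectively. (Strongly magic) There is exactly one quad code of length 16 containing $C_{sm}$, and it has dimension 11. Moreover, a quad code of length 16 and dimension $k\in\{7,8,9,10,11\}$ of any of these three kinds is realizable in the EvenQuads-$2^n$ deck exactly when $n\ge 15-k$; so the smallest deck realizing it has size $256,128,64,32,16$ for $k=7,8,9,10,11$ respectively.
   Context: The EvenQuads-$2^n$ deck is $\mathbb{Z}_2^n$; its elements are cards. A quad code of length $\ell$ is a linear subspace of $\mathbb{Z}_2^\ell$ in which every codeword has an even number of ones and every nonzero codeword has at least 4 ones. A sequence of pairwise distinct cards $\vec a_1,\dots,\vec a_\ell$ realizes the code $\{c\in\mathbb{Z}_2^\ell:\ c \text{ has an even number of ones},\ \sum_i c_i\vec a_i=\vec 0\}$; a code is realizable in the EvenQuads-$2^n$ deck if some such sequence in $\mathbb{Z}_2^n$ realizes it. Index the 16 positions of a $4\times4$ square by $1,\dots,16$ left-to-right, top-to-bottom. $C_s$ is the subspace of $\mathbb{Z}_2^{16}$ spanned by the four row words $1111000000000000$, $0000111100000000$, $0000000011110000$, $0000000000001111$ and the four column words $1000100010001000$, $0100010001000100$, $0010001000100010$, $0001000100010001$ (it has dimension 7); these are the codes of $4\times 4$ card arrangements in which every row and column is a quad (semimagic quad squares). $C_m$ is spanned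 by $C_s$ together with the diagonal words $1000010000100001$ and $0001001001001000$ (dimension 8; magic quad squares). For $C_{sm}$, identify the position in row $r$ and column $c$ ($r,c\in\{0,1,2,3\}$) with the vector $(\beta(r),\beta(c))\in\mathbb{Z}_2^2\times\mathbb{Z}_2^2=\mathbb{Z}_2^4$, where $\beta$ is the 2-bit binary representation; $C_{sm}$ is the subspace spanned by the indicator vectors of all sets of four distinct positions whose vectors sum to $\vec 0$ (dimension 11; strongly magic quad squares). -}

module Defs where

open import Data.Bool using (Bool; true; false; _xor_; _∨_)
open import Data.Nat using (ℕ; zero; suc; _+_; _≤_; _/_; _%_; _≡ᵇ_)
open import Data.Nat.Divisibility using (_∣_)
open import Data.Fin using (Fin; toℕ)
open import Data.Vec using (Vec; []; _∷_; zipWith; replicate; lookup; tabulate)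
open import Data.Product using (Σ; ∃; ∃-syntax; _×_)
open import Data.Sum using (_⊎_)
open import Relation.Binary.PropositionalEquality using (_≡_; _≢_; _≗_)
open import Function.Bundles using (_⇔_)

-- Z_2^ℓ : binary words of length ℓ (also the cards of the EvenQuads-2^ℓ deck)
Word : ℕ → Set
Word ℓ = Vec Bool ℓ

0w : ∀ {ℓ} → Word ℓ
0w {ℓ} = replicate ℓ false

infixl 6 _⊕_
_⊕_ : ∀ {ℓ} → Word ℓ → Word ℓ → Word ℓ
_⊕_ = zipWith _xor_

weight : ∀ {ℓ} → Word ℓ → ℕ
weight []           = 0
weight (true  ∷ w)  = suc (weight w)
weight (false ∷ w)  = weight w

lincomb : ∀ {k n} → Vec Bool k → Vec (Word n) k → Word n
lincomb []           []       = 0w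
lincomb (true  ∷ c)  (a ∷ as) = a ⊕ lincomb c as
lincomb (false ∷ c)  (a ∷ as) = lincomb c as

Code : ℕ → Set
Code ℓ = Word ℓ → Bool

Member : ∀ {ℓ} → Code ℓ → Word ℓ → Set
Member S w = S w ≡ true

IsSubspace : ∀ {ℓ} → Code ℓ → Set
IsSubspace S = Member S 0w × (∀ u v → Member S u → Member S v → Member S (u ⊕ v))

IsQuadCode : ∀ {ℓ} → Code ℓ → Set
IsQuadCode S = IsSubspace S
             × (∀ w → Member S w → 2 ∣ weight w)
             × (∀ w → Member S w → w ≢ 0w → 4 ≤ weight w)

HasDim : ∀ {ℓ} → Code ℓ → ℕ → Set
HasDim {ℓ} S k =
  Σ (Vec (Word ℓ) k) λ b →
      (∀ i → Member S (lookup b i))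
    × (∀ c → lincomb c b ≡ 0w → c ≡ replicate k false)
    × (∀ w → Member S w → ∃[ c ] lincomb c b ≡ w)

data Span {ℓ} (G : Word ℓ → Set) : Word ℓ → Set where
  span-0 : Span G 0w
  span-+ : ∀ {g w} → G g → Span G w → Span G (g ⊕ w)

Contains : ∀ {ℓ} → (Word ℓ → Set) → Code ℓ → Set
Contains G S = ∀ w → Span G w → Member S w

-- "there are exactly N codes satisfying P" (codes compared extensionally,
-- i.e. as subsets of Z_2^ℓ)
NumberOf : ∀ {ℓ} → ℕ → (Code ℓ → Set) → Set
NumberOf {ℓ} N P =
  Σ (Vec (Code ℓ) N) λ L →
      (∀ i → P (lookup L i))
    × (∀ i j → lookup L i ≗ lookup L j → i ≡ j)
    × (∀ S → P S → ∃[ i ] S ≗ lookup L i)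

Realizes : ∀ {ℓ n} → Vec (Word n) ℓ → Code ℓ → Set
Realizes a S =
    (∀ i j → lookup a i ≡ lookup a j → i ≡ j)
  × (∀ c → Member S c ⇔ (2 ∣ weight c × lincomb c a ≡ 0w))

Realizable : ∀ {ℓ} → ℕ → Code ℓ → Set
Realizable {ℓ} n S = Σ (Vec (Word n) ℓ) λ a → Realizes a S

-- The 4×4 square: position p ∈ Fin 16 (0-based, left-to-right, top-to-bottom)
-- lies in row p / 4 and column p % 4 (both 0-based).

row : Fin 16 → ℕ
row p = toℕ p / 4

col : Fin 16 → ℕ
col p = toℕ p % 4

rowWord : Fin 4 → Word 16
rowWord r = tabulate λ p → row p ≡ᵇ toℕ r

colWord : Fin 4 → Word 16
colWord c = tabulate λ p → col p ≡ᵇ toℕ c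

diagWord : Word 16
diagWord = tabulate λ p → row p ≡ᵇ col p

antidiagWord : Word 16
antidiagWord = tabulate λ p → (row p + col p) ≡ᵇ 3

GenS : Word 16 → Set
GenS w = (∃[ r ] w ≡ rowWord r) ⊎ (∃[ c ] w ≡ colWord c)

GenM : Word 16 → Set
GenM w = GenS w ⊎ (w ≡ diagWord ⊎ w ≡ antidiagWord)

β : ℕ → Word 2
β x = ((x / 2) % 2 ≡ᵇ 1) ∷ (x % 2 ≡ᵇ 1) ∷ []

posVec : Fin 16 → Word 4
posVec p with β (row p) | β (col p)
... | r₁ ∷ r₀ ∷ [] | c₁ ∷ c₀ ∷ [] = r₁ ∷ r₀ ∷ c₁ ∷ c₀ ∷ []

indicator4 : Fin 16 → Fin 16 → Fin 16 → Fin 16 → Word 16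
indicator4 p q r s = tabulate λ x →
  (toℕ x ≡ᵇ toℕ p) ∨ (toℕ x ≡ᵇ toℕ q) ∨ (toℕ x ≡ᵇ toℕ r) ∨ (toℕ x ≡ᵇ toℕ s)

GenSM : Word 16 → Set
GenSM w = ∃[ p ] ∃[ q ] ∃[ r ] ∃[ s ]
    (p ≢ q × p ≢ r × p ≢ s × q ≢ r × q ≢ s × r ≢ s)
  × (posVec p ⊕ posVec q ⊕ posVec r ⊕ posVec s ≡ 0w)
  × (w ≡ indicator4 p q r s)

SemimagicCode : Code 16 → Set
SemimagicCode S = IsQuadCode S × Contains GenS S

MagicCode : Code 16 → Set
MagicCode S = IsQuadCode S × Contains GenM S

StronglyMagicCode : Code 16 → Set
StronglyMagicCode S = IsQuadCode S × Contains GenSM S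

{-# OPTIONS --safe #-}

-- An even code is determined by its puncturing at the first position, and a subspace of
-- Z₂¹⁵ containing a subspace K of codimension m by its image in Z₂¹⁵/K ≅ Z₂ᵐ. The code is
-- a quad code exactly when that image avoids the (nonzero) classes of the words of weight 2.
-- Subspaces of Z₂ᵐ correspond bijectively to reduced echelon forms, and those avoiding the
-- bad classes are enumerated coordinate by coordinate, discarding every partial echelon form
-- that already meets a bad class.
--
-- A realization in Z₂ⁿ is a linear map from the 15-dimensional space of even words to Z₂ⁿ with
-- kernel S, so it needs 15 ≤ k + n; conversely the syndromes of the unit words, taken in the
-- quotient of Z₂¹⁵ by the punctured code, realize S, and are distinct since S has no
-- word of weight 2.

module Submission where

open import Defs
open import Data.Nat using (ℕ; _+_; _≤_)
open import Data.Product using (∃-syntax; _×_)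
open import Data.Sum using (_⊎_)
open import Function.Bundles using (_⇔_)

open import Algebra.Consequences.Propositional using (comm∧assoc⇒middleFour)
open import Data.Bool using (Bool; true; false; not; _xor_; _∧_; if_then_else_)
open import Data.Bool.Properties using (⇔→≡; ¬-not; xor-assoc; xor-comm; xor-identityˡ; xor-same)
import Data.Bool as Bool
open import Data.Fin as Fin using (Fin; zero; suc; toℕ; #_; combine; remQuot)
import Data.Fin.Properties as Finₚ
open import Data.List as List using (List; length; filter; cartesianProductWith)
open import Data.List.Membership.Propositional using (_∈_)
open import Data.List.Membership.Propositional.Properties
  using (∈-map⁺; ∈-map⁻; ∈-++⁺ˡ; ∈-++⁺ʳ; ∈-filter⁺; ∈-filter⁻; ∈-lookup;
         ∈-cartesianProductWith⁺; ∈-cartesianProductWith⁻)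
import Data.List.Membership.DecPropositional as DecMembership
open import Data.List.Relation.Unary.All as All using ([]; _∷_)
open import Data.List.Relation.Unary.AllPairs using ([]; _∷_)
open import Data.List.Relation.Unary.Any using (here; there; index)
open import Data.List.Relation.Unary.Any.Properties using (lookup-index)
open import Data.List.Relation.Unary.Unique.Propositional using (Unique)
import Data.List.Relation.Unary.Unique.Propositional.Properties as Uniqueₚ
import Data.Nat as ℕ
open import Data.Nat using (zero; suc; z≤n; s≤s; _*_; _^_)
open import Data.Nat.Divisibility using (_∣_; divides; ∣m+n∣m⇒∣n; n∣m*n; ∣1⇒≡1)
open import Data.Nat.Properties
  using (+-suc; +-identityʳ; +-cancelʳ-≡; +-cancelˡ-≡; +-cancelˡ-≤; +-cancelʳ-≤; +-monoʳ-≤;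
         ≤-antisym; ≤-trans; ≤-reflexive; ≮⇒≥; <⇒≱; ^-monoʳ-<; n<1+n; m≤n⇒m≤1+n)
open import Data.Product using (∃; ∃₂; _,_; proj₁; proj₂; uncurry)
open import Data.Sum using (inj₁; inj₂; [_,_]′)
open import Data.Vec as Vec using (Vec; []; _∷_; lookup; tabulate; tail)
open import Data.Vec.Properties
  using (≡-dec; ∷-injective; ∷-injectiveˡ; ∷-injectiveʳ; ++-injective; lookup-map; lookup∘tabulate;
         zipWith-assoc; zipWith-comm; zipWith-identityˡ)
open import Function using (_∘_; _$_; mk⇔; Injective)
open import Function.Bundles using (module Equivalence; module Inverse; module Injection)
open import Function.Properties.Inverse using (↔-sym; Inverse⇒Injection)
open import Relation.Binary.PropositionalEquality
open import Relation.Nullary using (¬_; Dec; yes; no; does; contradiction)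
open import Relation.Nullary.Decidable
  using (map′; _×-dec_; _→-dec_; _⊎-dec_; dec-true; decidable-stable; ¬?; toWitness)

open Equivalence using (to; from)

does⇒ : ∀ {A : Set} (a? : Dec A) → does a? ≡ true → A
does⇒ (yes a) _ = a

-- Words as vectors over Z₂.

infix 4 _≟ʷ_
_≟ʷ_ : ∀ {n} (v w : Word n) → Dec (v ≡ w)
_≟ʷ_ = ≡-dec Bool._≟_

⊕-assoc : ∀ {n} (u v w : Word n) → (u ⊕ v) ⊕ w ≡ u ⊕ (v ⊕ w)
⊕-assoc = zipWith-assoc xor-assoc

⊕-comm : ∀ {n} (u v : Word n) → u ⊕ v ≡ v ⊕ u
⊕-comm = zipWith-comm xor-comm

⊕-interchange : ∀ {n} (u v w x : Word n) → (u ⊕ v) ⊕ (w ⊕ x) ≡ (u ⊕ w) ⊕ (v ⊕ x)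
⊕-interchange = comm∧assoc⇒middleFour ⊕-comm ⊕-assoc

⊕-identityˡ : ∀ {n} (w : Word n) → 0w ⊕ w ≡ w
⊕-identityˡ = zipWith-identityˡ xor-identityˡ

⊕-identityʳ : ∀ {n} (w : Word n) → w ⊕ 0w ≡ w
⊕-identityʳ w = trans (⊕-comm w 0w) (⊕-identityˡ w)

⊕-self : ∀ {n} (w : Word n) → w ⊕ w ≡ 0w
⊕-self []      = refl
⊕-self (x ∷ w) = cong₂ _∷_ (xor-same x) (⊕-self w)

⊕-cancel : ∀ {n} (v w : Word n) → v ⊕ (v ⊕ w) ≡ w
⊕-cancel v w = begin
  v ⊕ (v ⊕ w) ≡⟨ ⊕-assoc v v w ⟨
  v ⊕ v ⊕ w   ≡⟨ cong (_⊕ w) (⊕-self v) ⟩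
  0w ⊕ w      ≡⟨ ⊕-identityˡ w ⟩
  w           ∎
  where open ≡-Reasoning

⊕≡0⇒≡ : ∀ {n} (v w : Word n) → v ⊕ w ≡ 0w → v ≡ w
⊕≡0⇒≡ v w eq = begin
  v           ≡⟨ ⊕-identityʳ v ⟨
  v ⊕ 0w      ≡⟨ cong (v ⊕_) eq ⟨
  v ⊕ (v ⊕ w) ≡⟨ ⊕-cancel v w ⟩
  w           ∎
  where open ≡-Reasoning

≡⇒⊕≡0 : ∀ {n} {v w : Word n} → v ≡ w → v ⊕ w ≡ 0w
≡⇒⊕≡0 refl = ⊕-self _

⊕-cancelʳ : ∀ {n} (u v w : Word n) → u ⊕ w ≡ v ⊕ w → u ≡ v
⊕-cancelʳ u v w eq = begin
  u           ≡⟨ ⊕-cancel w u ⟨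
  w ⊕ (w ⊕ u) ≡⟨ cong (w ⊕_) (trans (⊕-comm w u) (trans eq (⊕-comm v w))) ⟩
  w ⊕ (w ⊕ v) ≡⟨ ⊕-cancel w v ⟩
  v           ∎
  where open ≡-Reasoning

-- Exhaustive search over the 2ⁿ words. It finds pivots in `echelon`, fibre representatives in
-- `realizable⇒≤` and coefficients in `generated?`.
∃? : ∀ {n} {P : Word n → Set} → (∀ w → Dec (P w)) → Dec (∃ P)
∃? {zero}  P? = map′ ([] ,_) (λ { ([] , p) → p }) (P? [])
∃? {suc n} P? = map′
  [ (λ (w , p) → false ∷ w , p) , (λ (w , p) → true ∷ w , p) ]′
  (λ { (false ∷ w , p) → inj₁ (w , p) ; (true ∷ w , p) → inj₂ (w , p) })
  (∃? (P? ∘ (false ∷_)) ⊎-dec ∃? (P? ∘ (true ∷_)))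

-- Linear maps, linear combinations and cosets.

Linear : ∀ {m n} → (Word m → Word n) → Set
Linear h = ∀ v w → h (v ⊕ w) ≡ h v ⊕ h w

linear-0 : ∀ {m n} {h : Word m → Word n} → Linear h → h 0w ≡ 0w
linear-0 {h = h} h-lin = begin
  h 0w                ≡⟨ ⊕-cancel (h 0w) (h 0w) ⟨
  h 0w ⊕ (h 0w ⊕ h 0w) ≡⟨ cong (h 0w ⊕_) (h-lin 0w 0w) ⟨
  h 0w ⊕ h (0w ⊕ 0w)  ≡⟨ cong (λ z → h 0w ⊕ h z) (⊕-identityˡ 0w) ⟩
  h 0w ⊕ h 0w         ≡⟨ ⊕-self (h 0w) ⟩
  0w                  ∎
  where open ≡-Reasoning

lincomb-map : ∀ {m n k} {h : Word m → Word n} → Linear h →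
              ∀ c (b : Vec (Word m) k) → lincomb c (Vec.map h b) ≡ h (lincomb c b)
lincomb-map h-lin []          []      = sym (linear-0 h-lin)
lincomb-map h-lin (false ∷ c) (w ∷ b) = lincomb-map h-lin c b
lincomb-map {h = h} h-lin (true ∷ c) (w ∷ b) =
  trans (cong (h w ⊕_) (lincomb-map h-lin c b)) (sym (h-lin w _))

lincomb-⊕ : ∀ {n k} (c d : Vec Bool k) (b : Vec (Word n) k) →
            lincomb (c ⊕ d) b ≡ lincomb c b ⊕ lincomb d b
lincomb-⊕ []          []          []      = sym (⊕-self 0w)
lincomb-⊕ (false ∷ c) (false ∷ d) (w ∷ b) = lincomb-⊕ c d b
lincomb-⊕ (true ∷ c)  (false ∷ d) (w ∷ b) =
  trans (cong (w ⊕_) (lincomb-⊕ c d b)) (sym (⊕-assoc w _ _))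
lincomb-⊕ (false ∷ c) (true ∷ d)  (w ∷ b) = begin
  w ⊕ lincomb (c ⊕ d) b             ≡⟨ cong (w ⊕_) (trans (lincomb-⊕ c d b) (⊕-comm (lincomb c b) _)) ⟩
  w ⊕ (lincomb d b ⊕ lincomb c b)   ≡⟨ ⊕-assoc w _ _ ⟨
  w ⊕ lincomb d b ⊕ lincomb c b     ≡⟨ ⊕-comm (w ⊕ lincomb d b) _ ⟩
  lincomb c b ⊕ (w ⊕ lincomb d b)   ∎
  where open ≡-Reasoning
lincomb-⊕ (true ∷ c)  (true ∷ d)  (w ∷ b) = begin
  lincomb (c ⊕ d) b                         ≡⟨ lincomb-⊕ c d b ⟩
  lincomb c b ⊕ lincomb d b                 ≡⟨ ⊕-identityˡ _ ⟨
  0w ⊕ (lincomb c b ⊕ lincomb d b)          ≡⟨ cong (_⊕ _) (⊕-self w) ⟨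
  w ⊕ w ⊕ (lincomb c b ⊕ lincomb d b)       ≡⟨ ⊕-interchange w w _ _ ⟩
  w ⊕ lincomb c b ⊕ (w ⊕ lincomb d b)       ∎
  where open ≡-Reasoning

∷-linear : ∀ {n} → Linear {n} (false ∷_)
∷-linear v w = refl

member-resp : ∀ {n} {S T : Code n} → S ≗ T → ∀ w → Member S w → Member T w
member-resp S≗T w = trans (sym (S≗T w))

shift-member : ∀ {n} {S : Code n} → IsSubspace S → ∀ {u} → Member S u → ∀ w → S w ≡ S (u ⊕ w)
shift-member {S = S} (_ , S-⊕) {u} u∈S w = ⇔→≡ {z = true} (mk⇔ (S-⊕ u w u∈S)
  (λ uw∈S → subst (Member S) (⊕-cancel u w) (S-⊕ u (u ⊕ w) u∈S uw∈S)))

-- A subspace is a union of its own cosets. `classify` uses this to move a word to the chosen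
-- representative of its class.
congruent : ∀ {n} {S : Code n} → IsSubspace S → ∀ {v w} → Member S (v ⊕ w) → S v ≡ S w
congruent {S = S} S-sub {v} {w} vw∈S = sym (trans (shift-member S-sub vw∈S w) (cong S (begin
  v ⊕ w ⊕ w     ≡⟨ ⊕-assoc v w w ⟩
  v ⊕ (w ⊕ w)   ≡⟨ cong (v ⊕_) (⊕-self w) ⟩
  v ⊕ 0w        ≡⟨ ⊕-identityʳ v ⟩
  v             ∎)))
  where open ≡-Reasoning

-- Subspaces in reduced echelon form

-- Subspaces of Word m of codimension e: E describes the words w with false ∷ w in the
-- subspace, and the words w with true ∷ w in it are none for skip E, and those with
-- syndrome check E w = y for pivot y E.
data Ech : ℕ → ℕ → Set where
  []    : Ech 0 0
  skip  : ∀ {m e} → Ech m e → Ech (suc m) (suc e)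
  pivot : ∀ {m e} → Word e → Ech m e → Ech (suc m) e

scale : ∀ {n} → Bool → Word n → Word n
scale x y = if x then y else 0w

-- The quotient map of Z₂ᵐ by `⟦ E ⟧`, given by a parity-check matrix: the `skip` columns form the
-- identity matrix, and the `pivot` columns carry the stored syndromes, with zeros in the rows of
-- earlier skips.
check : ∀ {m e} → Ech m e → Word m → Word e
check []          []      = []
check (skip E)    (x ∷ w) = x ∷ check E w
check (pivot y E) (x ∷ w) = scale x y ⊕ check E w

⟦_⟧ : ∀ {m e} → Ech m e → Code m
⟦ E ⟧ w = does (check E w ≟ʷ 0w)

-- A linear right inverse of `check E` supported on the `skip` coordinates; it picks one
-- representative of every class modulo `⟦ E ⟧`.
section : ∀ {m e} → Ech m e → Word e → Word m
section []          []      = []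
section (skip E)    (x ∷ v) = x ∷ section E v
section (pivot _ E) v       = false ∷ section E v

dim : ∀ {m e} → Ech m e → ℕ
dim []          = 0
dim (skip E)    = dim E
dim (pivot _ E) = suc (dim E)

-- The rows of the reduced echelon matrix: since `section` vanishes at the pivots, each row has a
-- one at its own pivot and zeros at the others.
basis : ∀ {m e} (E : Ech m e) → Vec (Word m) (dim E)
basis []          = []
basis (skip E)    = Vec.map (false ∷_) (basis E)
basis (pivot y E) = (true ∷ section E y) ∷ Vec.map (false ∷_) (basis E)

-- The echelon form of the preimage of `⟦ E ⟧` under `check K`. The `skip` coordinates of `K` are
-- the coordinates of Z₂ᵐ and follow `E`; a pivot column of `K` is pushed through `check E`.
compose : ∀ {ℓ m e} → Ech ℓ m → Ech m e → Ech ℓ e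
compose []          []          = []
compose (skip K)    (skip E)    = skip (compose K E)
compose (skip K)    (pivot y E) = pivot y (compose K E)
compose (pivot z K) E           = pivot (check E z) (compose K E)

scale-xor : ∀ {n} x x′ (y : Word n) → scale (x xor x′) y ≡ scale x y ⊕ scale x′ y
scale-xor false x′    y = sym (⊕-identityˡ _)
scale-xor true  false y = sym (⊕-identityʳ y)
scale-xor true  true  y = sym (⊕-self y)

check-linear : ∀ {m e} (E : Ech m e) → Linear (check E)
check-linear []          []      []        = refl
check-linear (skip E)    (x ∷ v) (x′ ∷ w)  = cong (_ ∷_) (check-linear E v w)
check-linear (pivot y E) (x ∷ v) (x′ ∷ w)  =
  trans (cong₂ _⊕_ (scale-xor x x′ y) (check-linear E v w)) (⊕-interchange (scale x y) _ _ _)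

check-section : ∀ {m e} (E : Ech m e) v → check E (section E v) ≡ v
check-section []          []      = refl
check-section (skip E)    (x ∷ v) = cong (x ∷_) (check-section E v)
check-section (pivot _ E) v       = trans (⊕-identityˡ _) (check-section E v)

section-linear : ∀ {m e} (E : Ech m e) → Linear (section E)
section-linear []          []      []       = refl
section-linear (skip E)    (x ∷ v) (x′ ∷ w) = cong (_ ∷_) (section-linear E v w)
section-linear (pivot _ E) v       w        = cong (false ∷_) (section-linear E v w)

check-scale : ∀ {m e} (E : Ech m e) x w → check E (scale x w) ≡ scale x (check E w)
check-scale E false w = linear-0 (check-linear E)
check-scale E true  w = refl

check-compose : ∀ {ℓ m e} (K : Ech ℓ m) (E : Ech m e) w →
                check (compose K E) w ≡ check E (check K w)
check-compose []          []          []      = refl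
check-compose (skip K)    (skip E)    (x ∷ w) = cong (x ∷_) (check-compose K E w)
check-compose (skip K)    (pivot y E) (x ∷ w) = cong (scale x y ⊕_) (check-compose K E w)
check-compose (pivot z K) E           (x ∷ w) = trans
  (cong₂ _⊕_ (sym (check-scale E x z)) (check-compose K E w))
  (sym (check-linear E (scale x z) (check K w)))

dim+codim : ∀ {m e} (E : Ech m e) → dim E + e ≡ m
dim+codim []          = refl
dim+codim (skip E)    = trans (+-suc (dim E) _) (cong suc (dim+codim E))
dim+codim (pivot _ E) = cong suc (dim+codim E)

codim≤ : ∀ {m e} → Ech m e → e ≤ m
codim≤ []          = z≤n
codim≤ (skip E)    = s≤s (codim≤ E)
codim≤ (pivot _ E) = m≤n⇒m≤1+n (codim≤ E)

∈⟦⟧⇒ : ∀ {m e} (E : Ech m e) {w} → Member ⟦ E ⟧ w → check E w ≡ 0w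
∈⟦⟧⇒ E = does⇒ (_ ≟ʷ _)

⇒∈⟦⟧ : ∀ {m e} (E : Ech m e) {w} → check E w ≡ 0w → Member ⟦ E ⟧ w
⇒∈⟦⟧ E = dec-true (_ ≟ʷ _)

⟦⟧-isSubspace : ∀ {m e} (E : Ech m e) → IsSubspace ⟦ E ⟧
⟦⟧-isSubspace E = ⇒∈⟦⟧ E (linear-0 (check-linear E)) , λ u v u∈ v∈ → ⇒∈⟦⟧ E (begin
  check E (u ⊕ v)         ≡⟨ check-linear E u v ⟩
  check E u ⊕ check E v   ≡⟨ cong₂ _⊕_ (∈⟦⟧⇒ E u∈) (∈⟦⟧⇒ E v∈) ⟩
  0w ⊕ 0w                 ≡⟨ ⊕-self 0w ⟩
  0w                      ∎)
  where open ≡-Reasoning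

⟦⟧-cong : ∀ {m m′ e} (E : Ech m e) (F : Ech m′ e) {v w} → check E v ≡ check F w → ⟦ E ⟧ v ≡ ⟦ F ⟧ w
⟦⟧-cong E F = cong (λ y → does (y ≟ʷ 0w))

⟦compose⟧ : ∀ {ℓ m e} (K : Ech ℓ m) (E : Ech m e) w → ⟦ compose K E ⟧ w ≡ ⟦ E ⟧ (check K w)
⟦compose⟧ K E w = ⟦⟧-cong (compose K E) E (check-compose K E w)

⟦pivot⟧ : ∀ {m e} (y : Word e) (E : Ech m e) w → ⟦ pivot y E ⟧ (false ∷ w) ≡ ⟦ E ⟧ w
⟦pivot⟧ y E w = ⟦⟧-cong (pivot y E) E (⊕-identityˡ (check E w))

section∈pivot : ∀ {m e} (y : Word e) (E : Ech m e) → Member ⟦ pivot y E ⟧ (true ∷ section E y)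
section∈pivot y E = ⇒∈⟦⟧ (pivot y E) (≡⇒⊕≡0 (sym (check-section E y)))

-- The word `true ∷ section F z` lies in the code of `pivot z F` but in no code of the form
-- `skip E`, which refutes the mixed cases. For two pivots the tails agree by recursion, and the
-- syndrome of the section recovers the pivot column.
⟦⟧-injective : ∀ {m e} (E F : Ech m e) → ⟦ E ⟧ ≗ ⟦ F ⟧ → E ≡ F
⟦⟧-injective []          []          _  = refl
⟦⟧-injective (skip E)    (skip F)    eq = cong skip (⟦⟧-injective E F (eq ∘ (false ∷_)))
⟦⟧-injective (skip E)    (pivot z F) eq
  with () ← trans (eq (true ∷ section F z)) (section∈pivot z F)
⟦⟧-injective (pivot y E) (skip F)    eq
  with () ← trans (sym (eq (true ∷ section E y))) (section∈pivot y E)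
⟦⟧-injective (pivot y E) (pivot z F) eq
  with refl ← ⟦⟧-injective E F
         (λ w → trans (sym (⟦pivot⟧ y E w)) (trans (eq (false ∷ w)) (⟦pivot⟧ z F w)))
  = cong (λ x → pivot x E) (sym (trans
      (⊕≡0⇒≡ z _ (∈⟦⟧⇒ (pivot z E) (trans (sym (eq (true ∷ section E y))) (section∈pivot y E))))
      (check-section E y)))

-- The members beginning with `true` are either absent or form a coset `u` + (members beginning with
-- `false`); the pivot column is then the syndrome of `u`.
echelon : ∀ {m} (S : Code m) → IsSubspace S → ∃₂ λ e (E : Ech m e) → S ≗ ⟦ E ⟧
echelon {zero}  S (0∈S , _) = 0 , [] , λ { [] → 0∈S }
echelon {suc m} S S-sub@(0∈S , S-⊕)
  with echelon (S ∘ (false ∷_)) (0∈S , λ u v → S-⊕ (false ∷ u) (false ∷ v))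
     | ∃? (λ w → S (true ∷ w) Bool.≟ true)
... | e , E , eq | no ∄ = suc e , skip E , λ
  { (false ∷ w) → eq w
  ; (true ∷ w)  → ¬-not (λ w∈S → ∄ (w , w∈S)) }
... | e , E , eq | yes (u , u∈S) = e , pivot (check E u) E , λ
  { (false ∷ w) → trans (eq w) (sym (⟦pivot⟧ (check E u) E w))
  ; (true ∷ w)  → trans (shift-member S-sub u∈S (true ∷ w)) (trans (eq (u ⊕ w))
      (⟦⟧-cong E (pivot (check E u) E) {w = true ∷ w} (check-linear E u w))) }

hasDim-resp : ∀ {n k} {S T : Code n} → S ≗ T → HasDim S k → HasDim T k
hasDim-resp S≗T (b , mem , ind , spn) =
  b , (λ i → member-resp S≗T _ (mem i)) , ind , λ w → spn w ∘ member-resp (sym ∘ S≗T) w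

⟦⟧-hasDim : ∀ {m e} (E : Ech m e) → HasDim ⟦ E ⟧ (dim E)
⟦⟧-hasDim E = basis E , basis-member E , basis-independent E , basis-spans E
  where
  lincomb-false∷ : ∀ {n k} c (b : Vec (Word n) k) →
                   lincomb c (Vec.map (false ∷_) b) ≡ false ∷ lincomb c b
  lincomb-false∷ = lincomb-map ∷-linear

  basis-member : ∀ {m e} (E : Ech m e) i → Member ⟦ E ⟧ (lookup (basis E) i)
  basis-member (skip E)    i       =
    trans (cong ⟦ skip E ⟧ (lookup-map i (false ∷_) (basis E))) (basis-member E i)
  basis-member (pivot y E) zero    = section∈pivot y E
  basis-member (pivot y E) (suc i) =
    trans (cong ⟦ pivot y E ⟧ (lookup-map i (false ∷_) (basis E)))
          (trans (⟦pivot⟧ y E _) (basis-member E i))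

  basis-independent : ∀ {m e} (E : Ech m e) c → lincomb c (basis E) ≡ 0w → c ≡ 0w
  basis-independent []          []          _  = refl
  basis-independent (skip E)    c           eq =
    basis-independent E c (∷-injectiveʳ (trans (sym (lincomb-false∷ c (basis E))) eq))
  basis-independent (pivot y E) (false ∷ c) eq = cong (false ∷_)
    (basis-independent E c (∷-injectiveʳ (trans (sym (lincomb-false∷ c (basis E))) eq)))
  -- Only the first basis word begins with `true`, so the combination begins with `true` and is not
  -- zero.
  basis-independent (pivot y E) (true ∷ c)  eq
    with () ← trans (sym (cong ((true ∷ section E y) ⊕_) (lincomb-false∷ c (basis E)))) eq

  basis-spans : ∀ {m e} (E : Ech m e) w → Member ⟦ E ⟧ w → ∃[ c ] lincomb c (basis E) ≡ w
  basis-spans []          []          _  = [] , refl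
  basis-spans (skip E)    (false ∷ w) w∈ =
    let c , eq = basis-spans E w w∈ in c , trans (lincomb-false∷ c (basis E)) (cong (false ∷_) eq)
  basis-spans (pivot y E) (false ∷ w) w∈ =
    let c , eq = basis-spans E w (trans (sym (⟦pivot⟧ y E w)) w∈)
    in false ∷ c , trans (lincomb-false∷ c (basis E)) (cong (false ∷_) eq)
  -- Adding the leading basis word clears the first bit and leaves a member of the tail.
  basis-spans (pivot y E) (true ∷ w)  w∈ =
    let s = section E y
        c , eq = basis-spans E (s ⊕ w) (⇒∈⟦⟧ E (trans (check-linear E s w)
                   (trans (cong (_⊕ _) (check-section E y)) (∈⟦⟧⇒ (pivot y E) w∈))))
    in true ∷ c , trans (cong ((true ∷ s) ⊕_) (trans (lincomb-false∷ c (basis E)) (cong (false ∷_) eq)))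
                        (cong (true ∷_) (⊕-cancel s w))

-- Dimension counting

word→Fin : ∀ {n} → Word n → Fin (2 ^ n)
word→Fin []      = zero
word→Fin (x ∷ w) = combine (Inverse.from Finₚ.2↔Bool x) (word→Fin w)

word→Fin-injective : ∀ {n} {v w : Word n} → word→Fin v ≡ word→Fin w → v ≡ w
word→Fin-injective {v = []}    {[]}    _  = refl
word→Fin-injective {v = x ∷ v} {y ∷ w} eq =
  let p , q = Finₚ.combine-injective _ (word→Fin v) _ (word→Fin w) eq in
  cong₂ _∷_ (Injection.injective (Inverse⇒Injection (↔-sym Finₚ.2↔Bool)) p) (word→Fin-injective q)

Fin→word : ∀ n → Fin (2 ^ n) → Word n
Fin→word zero    _ = []
Fin→word (suc n) i =
  let b , j = remQuot {2} (2 ^ n) i in Inverse.to Finₚ.2↔Bool b ∷ Fin→word n j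

Fin→word-injective : ∀ n {i j} → Fin→word n i ≡ Fin→word n j → i ≡ j
Fin→word-injective zero    {zero} {zero} _ = refl
Fin→word-injective (suc n) {i} {j} eq = begin
  i                                          ≡⟨ Finₚ.combine-remQuot {2} (2 ^ n) i ⟨
  uncurry combine (remQuot {2} (2 ^ n) i)    ≡⟨ cong₂ combine
                                                  (Injection.injective (Inverse⇒Injection Finₚ.2↔Bool) (∷-injectiveˡ eq))
                                                  (Fin→word-injective n (∷-injectiveʳ eq)) ⟩
  uncurry combine (remQuot {2} (2 ^ n) j)    ≡⟨ Finₚ.combine-remQuot {2} (2 ^ n) j ⟩
  j                                          ∎
  where open ≡-Reasoning

-- Pigeonhole on 2ᵐ and 2ⁿ words. Both `hasDim-≤` and `realizable⇒≤` compare dimensions by counting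
-- in this way.
word-injective⇒≤ : ∀ {m n} (f : Word m → Word n) → Injective _≡_ _≡_ f → m ≤ n
word-injective⇒≤ {m} {n} f f-inj = ≮⇒≥ λ n<m → <⇒≱ (^-monoʳ-< 2 (n<1+n 1) n<m)
  (Finₚ.injective⇒≤ {f = word→Fin ∘ f ∘ Fin→word m}
    (Fin→word-injective m ∘ f-inj ∘ word→Fin-injective))

lincomb-injective : ∀ {n k} (b : Vec (Word n) k) → (∀ c → lincomb c b ≡ 0w → c ≡ 0w) →
                    Injective _≡_ _≡_ (λ c → lincomb c b)
lincomb-injective b ind {c} {d} eq =
  ⊕≡0⇒≡ c d (ind _ (trans (lincomb-⊕ c d b) (≡⇒⊕≡0 eq)))

lincomb-member : ∀ {n k} {S : Code n} → IsSubspace S → (b : Vec (Word n) k) →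
                 (∀ i → Member S (lookup b i)) → ∀ c → Member S (lincomb c b)
lincomb-member (0∈S , _) []      _   []          = 0∈S
lincomb-member S-sub     (w ∷ b) mem (false ∷ c) = lincomb-member S-sub b (mem ∘ suc) c
lincomb-member S-sub     (w ∷ b) mem (true ∷ c)  =
  proj₂ S-sub w _ (mem zero) (lincomb-member S-sub b (mem ∘ suc) c)

-- Rewriting the combinations of one basis in the coordinates of the other is injective on
-- coefficient vectors.
hasDim-≤ : ∀ {n k l} {S : Code n} → IsSubspace S → HasDim S k → HasDim S l → k ≤ l
hasDim-≤ S-sub (b , mem , ind , _) (b′ , _ , _ , spn) =
  word-injective⇒≤ (λ c → proj₁ (coords c)) λ {c} {d} eq → lincomb-injective b ind
    (trans (sym (proj₂ (coords c))) (trans (cong (λ x → lincomb x b′) eq) (proj₂ (coords d))))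
  where
  coords : ∀ c → ∃[ d ] lincomb d b′ ≡ lincomb c b
  coords c = spn _ (lincomb-member S-sub b mem c)

hasDim-unique : ∀ {n k l} {S : Code n} → IsSubspace S → HasDim S k → HasDim S l → k ≡ l
hasDim-unique S-sub k l = ≤-antisym (hasDim-≤ S-sub k l) (hasDim-≤ S-sub l k)

-- Enumeration of the subspaces avoiding a given set

-- Sets of words are tabulated as tries, so that membership is computed once per word.
data Trie : ℕ → Set where
  leaf : Bool → Trie 0
  node : ∀ {m} → Trie m → Trie m → Trie (suc m)

lookupᵗ : ∀ {m} → Trie m → Word m → Bool
lookupᵗ (leaf b)   []          = b
lookupᵗ (node l r) (false ∷ w) = lookupᵗ l w
lookupᵗ (node l r) (true ∷ w)  = lookupᵗ r w

memo : ∀ {m} → (Word m → Bool) → Trie m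
memo {zero}  f = leaf (f [])
memo {suc m} f = node (memo (f ∘ (false ∷_))) (memo (f ∘ (true ∷_)))

lookup-memo : ∀ {m} (f : Word m → Bool) w → lookupᵗ (memo f) w ≡ f w
lookup-memo f []          = refl
lookup-memo f (false ∷ w) = lookup-memo (f ∘ (false ∷_)) w
lookup-memo f (true ∷ w)  = lookup-memo (f ∘ (true ∷_)) w

infix 4 _∈?_
_∈?_ : ∀ {m} (w : Word m) (ws : List (Word m)) → Dec (w ∈ ws)
_∈?_ = DecMembership._∈?_ _≟ʷ_

-- As a parameter, ws is evaluated once and not once per word.
fromList : ∀ {m} → List (Word m) → Trie m
fromList ws = memo (λ w → does (w ∈? ws))

∈⇒lookup-fromList : ∀ {m} (ws : List (Word m)) {w} → w ∈ ws → lookupᵗ (fromList ws) w ≡ true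
∈⇒lookup-fromList ws {w} w∈ = trans (lookup-memo _ w) (dec-true (w ∈? ws) w∈)

lookup-fromList⇒∈ : ∀ {m} (ws : List (Word m)) {w} → lookupᵗ (fromList ws) w ≡ true → w ∈ ws
lookup-fromList⇒∈ ws {w} eq = does⇒ (w ∈? ws) (trans (sym (lookup-memo _ w)) eq)

-- Stated for an arbitrary class `y`, because under a pivot `z` the tails of the words beginning
-- with `true` lie in the class `z ⊕ y`.
AvoidsAt : ∀ {m e} → Trie m → Ech m e → Word e → Set
AvoidsAt t E y = ∀ w → check E w ≡ y → lookupᵗ t w ≡ false

Avoids : ∀ {m e} → Trie m → Ech m e → Set
Avoids t E = AvoidsAt t E 0w

avoidsAt? : ∀ {m e} (t : Trie m) (E : Ech m e) (y : Word e) → Dec (AvoidsAt t E y)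
avoidsAt? (leaf b) [] [] = map′ (λ { p [] _ → p }) (λ h → h [] refl) (b Bool.≟ false)
avoidsAt? (node l r) (skip E) (false ∷ y) = map′
  (λ { h (false ∷ w) eq → h w (∷-injectiveʳ eq) ; h (true ∷ w) () })
  (λ h w eq → h (false ∷ w) (cong (false ∷_) eq))
  (avoidsAt? l E y)
avoidsAt? (node l r) (skip E) (true ∷ y) = map′
  (λ { h (false ∷ w) () ; h (true ∷ w) eq → h w (∷-injectiveʳ eq) })
  (λ h w eq → h (true ∷ w) (cong (true ∷_) eq))
  (avoidsAt? r E y)
avoidsAt? (node l r) (pivot z E) y = map′
  (λ { (h , k) (false ∷ w) eq → k w (trans (sym (⊕-identityˡ _)) eq)
     ; (h , k) (true ∷ w)  eq → h w (trans (sym (⊕-cancel z _)) (cong (z ⊕_) eq)) })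
  (λ h → (λ w eq → h (true ∷ w) (trans (cong (z ⊕_) eq) (⊕-cancel z y)))
       , (λ w eq → h (false ∷ w) (trans (⊕-identityˡ _) eq)))
  -- For a pivot candidate of `echelons` the tail `E` is known to avoid `l`, so the right subtree,
  -- where failure is possible, is tested first.
  (avoidsAt? r E (z ⊕ y) ×-dec avoidsAt? l E y)

avoids? : ∀ {m e} (t : Trie m) (E : Ech m e) → Dec (Avoids t E)
avoids? t E = avoidsAt? t E 0w

words : ∀ n → List (Word n)
words zero    = List.[ [] ]
words (suc n) = cartesianProductWith _∷_ (false List.∷ true List.∷ List.[]) (words n)

∈-words : ∀ {n} (w : Word n) → w ∈ words n
∈-words []      = here refl
∈-words (x ∷ w) = ∈-cartesianProductWith⁺ _∷_ (∈-bits x) (∈-words w)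
  where
  ∈-bits : ∀ x → x ∈ false List.∷ true List.∷ List.[]
  ∈-bits false = here refl
  ∈-bits true  = there (here refl)

words-unique : ∀ n → Unique (words n)
words-unique zero    = [] ∷ []
words-unique (suc n) =
  Uniqueₚ.cartesianProductWith⁺ _∷_ ∷-injective (((λ ()) ∷ []) ∷ [] ∷ []) (words-unique n)

-- The tail of an echelon form over `node l r` describes the words beginning with `false`, hence
-- must itself avoid `l`: only the pruned list for `l` is extended. `skips` is separate because a
-- skip lowers the codimension of the tail by one.
echelons skips : ∀ {m} → Trie m → ∀ e → List (Ech m e)

echelons t@(leaf _)   zero    = filter (avoids? t) List.[ [] ]
echelons   (leaf _)   (suc e) = List.[]
echelons t@(node l _) e       =
  filter (avoids? t) (skips t e List.++ cartesianProductWith pivot (words e) (echelons l e))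

skips t          zero    = List.[]
skips (leaf _)   (suc e) = List.[]
skips (node l _) (suc e) = List.map skip (echelons l e)

∈-echelons⁻ : ∀ {m e} (t : Trie m) {E : Ech m e} → E ∈ echelons t e → Avoids t E
∈-echelons⁻ {e = zero} t@(leaf _) E∈ = proj₂ (∈-filter⁻ (avoids? t) {xs = List.[ [] ]} E∈)
∈-echelons⁻ {e = e} t@(node l _)  E∈ =
  proj₂ (∈-filter⁻ (avoids? t)
    {xs = skips t e List.++ cartesianProductWith pivot (words e) (echelons l e)} E∈)

-- Pruning loses nothing, since the tail inherits avoidance through the words `false ∷ w`.
∈-echelons⁺ : ∀ {m e} (t : Trie m) (E : Ech m e) → Avoids t E → E ∈ echelons t e
∈-echelons⁺ t@(leaf _)   []          av = ∈-filter⁺ (avoids? t) (here refl) av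
∈-echelons⁺ t@(node l _) (skip E)    av = ∈-filter⁺ (avoids? t)
  (∈-++⁺ˡ (∈-map⁺ skip (∈-echelons⁺ l E λ w → av (false ∷ w) ∘ cong (false ∷_)))) av
∈-echelons⁺ t@(node l _) (pivot y E) av = ∈-filter⁺ (avoids? t)
  (∈-++⁺ʳ (skips t _) (∈-cartesianProductWith⁺ pivot (∈-words y)
    (∈-echelons⁺ l E λ w → av (false ∷ w) ∘ trans (⊕-identityˡ _)))) av

echelons-unique : ∀ {m} (t : Trie m) e → Unique (echelons t e)
echelons-unique t@(leaf _)   zero    = Uniqueₚ.filter⁺ (avoids? t) {xs = List.[ [] ]} ([] ∷ [])
echelons-unique   (leaf _)   (suc e) = []
echelons-unique t@(node l _) e       = Uniqueₚ.filter⁺ (avoids? t) (Uniqueₚ.++⁺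
  (skips-unique e)
  (Uniqueₚ.cartesianProductWith⁺ pivot (λ { refl → refl , refl })
    (words-unique e) (echelons-unique l e))
  (disjoint e))
  where
  skips-unique : ∀ e → Unique (skips t e)
  skips-unique zero    = []
  skips-unique (suc e) = Uniqueₚ.map⁺ (λ { refl → refl }) (echelons-unique l e)

  disjoint : ∀ e {E} → ¬ (E ∈ skips t e × E ∈ cartesianProductWith pivot (words e) (echelons l e))
  disjoint (suc e) (E∈skips , E∈pivots)
    with _ , _ , refl ← ∈-map⁻ skip E∈skips
    with _ , _ , _ , _ , () ← ∈-cartesianProductWith⁻ pivot (words (suc e)) (echelons l (suc e)) E∈pivots

-- Even codes and their puncturings

parity : ∀ {n} → Word n → Bool
parity []      = false
parity (x ∷ w) = x xor parity w

parity-⊕ : ∀ {n} (v w : Word n) → parity (v ⊕ w) ≡ parity v xor parity w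
parity-⊕ []      []      = refl
parity-⊕ (x ∷ v) (y ∷ w) = trans (cong ((x xor y) xor_) (parity-⊕ v w))
  (comm∧assoc⇒middleFour xor-comm xor-assoc x y (parity v) (parity w))

parity-0 : ∀ n → parity (0w {n}) ≡ false
parity-0 zero    = refl
parity-0 (suc n) = parity-0 n

-- Links divisibility of the weight to `parity`, which is additive over `⊕` while the weight is not.
weight-parity : ∀ {n} (w : Word n) → ∃[ q ] weight w ≡ q * 2 + (if parity w then 1 else 0)
weight-parity []          = 0 , refl
weight-parity (false ∷ w) = weight-parity w
weight-parity (true ∷ w) with parity w | weight-parity w
... | false | q , eq = q , trans (cong suc eq) (sym (+-suc (q * 2) 0))
... | true  | q , eq = suc q , cong suc (trans eq (+-suc (q * 2) 0))

even⇒parity : ∀ {n} (w : Word n) → 2 ∣ weight w → parity w ≡ false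
even⇒parity w 2∣w with parity w | weight-parity w
... | false | _      = refl
... | true  | q , eq with () ← ∣1⇒≡1 (∣m+n∣m⇒∣n (subst (2 ∣_) eq 2∣w) (n∣m*n q))

parity⇒even : ∀ {n} (w : Word n) → parity w ≡ false → 2 ∣ weight w
parity⇒even w eq with parity w | weight-parity w
... | false | q , eq′ = divides q (trans eq′ (+-identityʳ (q * 2)))

-- Inverse to puncturing on even words: the deleted bit is the parity of the rest.
extend : ∀ {n} → Word n → Word (suc n)
extend w = parity w ∷ w

extend-linear : ∀ {n} → Linear (extend {n})
extend-linear v w = cong (_∷ v ⊕ w) (parity-⊕ v w)

extend-tail : ∀ {n} (w : Word (suc n)) → parity w ≡ false → extend (tail w) ≡ w
extend-tail (false ∷ w) eq = cong (_∷ w) eq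
extend-tail (true ∷ w)  eq with true ← parity w = refl

evenExtension : ∀ {n} → Code n → Code (suc n)
evenExtension P w = not (parity w) ∧ P (tail w)

∈-evenExtension⁻ : ∀ {n} (P : Code n) w → Member (evenExtension P) w → parity w ≡ false × Member P (tail w)
∈-evenExtension⁻ P w w∈ with false ← parity w = refl , w∈

∈-evenExtension⁺ : ∀ {n} (P : Code n) w → parity w ≡ false → Member P (tail w) → Member (evenExtension P) w
∈-evenExtension⁺ P w even w∈ = cong₂ (λ x y → not x ∧ y) even w∈

evenExtension-extend : ∀ {n} (P : Code n) w → evenExtension P (extend w) ≡ P w
evenExtension-extend P w = cong (λ x → not x ∧ P w) (xor-same (parity w))

evenExtension-isSubspace : ∀ {n} {P : Code n} → IsSubspace P → IsSubspace (evenExtension P)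
evenExtension-isSubspace {n} {P} (0∈P , P-⊕) =
    ∈-evenExtension⁺ P 0w (parity-0 n) 0∈P
  , λ { u@(_ ∷ _) v@(_ ∷ _) u∈ v∈ →
        let pu , tu = ∈-evenExtension⁻ P u u∈
            pv , tv = ∈-evenExtension⁻ P v v∈
        in ∈-evenExtension⁺ P (u ⊕ v) (trans (parity-⊕ u v) (cong₂ _xor_ pu pv)) (P-⊕ _ _ tu tv) }

-- An even word is the extension of its tail, and an odd word lies in neither code.
puncture-evenExtension : ∀ {n} (S : Code (suc n)) → (∀ w → Member S w → 2 ∣ weight w) →
                         S ≗ evenExtension (S ∘ extend)
puncture-evenExtension S S-even w with parity w in eq
... | false = cong S (sym (extend-tail w eq))
... | true  = ¬-not λ w∈S → contradiction (trans (sym eq) (even⇒parity w (S-even w w∈S))) λ ()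

evenExtension-hasDim : ∀ {n k} {P : Code n} → HasDim P k → HasDim (evenExtension P) k
evenExtension-hasDim {P = P} (b , mem , ind , spn) =
    Vec.map extend b
  , (λ i → trans (cong (evenExtension P) (lookup-map i extend b))
                 (trans (evenExtension-extend P (lookup b i)) (mem i)))
  , (λ c eq → ind c (∷-injectiveʳ (trans (sym (lincomb-map extend-linear c b)) eq)))
  , λ w w∈ →
      let even , w′∈ = ∈-evenExtension⁻ P w w∈
          c , eq = spn (tail w) w′∈
      in c , trans (lincomb-map extend-linear c b) (trans (cong extend eq) (extend-tail w even))

-- Quad codes containing a given code

-- A nonzero even word of weight below 4 has weight 2, so these are the classes modulo `K` that a
-- quad code has to omit.
lightSyndromes : ∀ {ℓ m} → Ech ℓ m → List (Word m)
lightSyndromes K = List.map (check K ∘ tail) (filter (λ w → weight w ℕ.≟ 2) (words _))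

bad : ∀ {ℓ m} → Ech ℓ m → Trie m
bad K = fromList (lightSyndromes K)

bad⁺ : ∀ {ℓ m} (K : Ech ℓ m) w → weight w ≡ 2 → lookupᵗ (bad K) (check K (tail w)) ≡ true
bad⁺ K w w≡2 = ∈⇒lookup-fromList (lightSyndromes K)
  (∈-map⁺ (check K ∘ tail) (∈-filter⁺ (λ w → weight w ℕ.≟ 2) (∈-words w) w≡2))

bad⁻ : ∀ {ℓ m} (K : Ech ℓ m) v → lookupᵗ (bad K) v ≡ true →
       ∃[ w ] (weight w ≡ 2 × v ≡ check K (tail w))
bad⁻ K v v∈bad =
  let w , w∈ , v≡ = ∈-map⁻ (check K ∘ tail) (lookup-fromList⇒∈ (lightSyndromes K) v∈bad)
  in w , proj₂ (∈-filter⁻ (λ w → weight w ℕ.≟ 2) {xs = words _} w∈) , v≡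

weight-0w : ∀ n → weight (0w {n}) ≡ 0
weight-0w zero    = refl
weight-0w (suc n) = weight-0w n

weight≡0⇒≡0w : ∀ {n} (w : Word n) → weight w ≡ 0 → w ≡ 0w
weight≡0⇒≡0w []          _  = refl
weight≡0⇒≡0w (false ∷ w) eq = cong (false ∷_) (weight≡0⇒≡0w w eq)

codeOver : ∀ {ℓ m e} → Ech ℓ m → Ech m e → Code (suc ℓ)
codeOver K E = evenExtension ⟦ compose K E ⟧

codeOver-⊇ : ∀ {ℓ m e} (K : Ech ℓ m) (E : Ech m e) w →
             Member (evenExtension ⟦ K ⟧) w → Member (codeOver K E) w
codeOver-⊇ K E w w∈ =
  let even , w′∈ = ∈-evenExtension⁻ ⟦ K ⟧ w w∈ in
  ∈-evenExtension⁺ ⟦ compose K E ⟧ w even (⇒∈⟦⟧ (compose K E) (trans (check-compose K E (tail w))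
    (trans (cong (check E) (∈⟦⟧⇒ K w′∈)) (linear-0 (check-linear E)))))

-- Every class `v` is the syndrome of the even word `extend (section K v)`, so membership in `⟦ E ⟧`
-- can be read off the code.
codeOver-injective : ∀ {ℓ m e} (K : Ech ℓ m) {E F : Ech m e} → codeOver K E ≗ codeOver K F → E ≡ F
codeOver-injective K {E} {F} eq = ⟦⟧-injective E F λ v →
  trans (sym (at-section E v)) (trans (eq (extend (section K v))) (at-section F v))
  where
  at-section : ∀ E v → codeOver K E (extend (section K v)) ≡ ⟦ E ⟧ v
  at-section E v = trans (evenExtension-extend ⟦ compose K E ⟧ (section K v))
    (trans (⟦compose⟧ K E (section K v)) (cong ⟦ E ⟧ (check-section K v)))

avoids⇒isQuadCode : ∀ {ℓ m e} (K : Ech ℓ m) (E : Ech m e) → Avoids (bad K) E → IsQuadCode (codeOver K E)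
avoids⇒isQuadCode K E av =
  evenExtension-isSubspace (⟦⟧-isSubspace (compose K E)) , even , λ w w∈ w≢0 →
    atLeast4 w w∈ w≢0 (weight w) refl (even w w∈)
  where
  P = ⟦ compose K E ⟧

  even : ∀ w → Member (codeOver K E) w → 2 ∣ weight w
  even w w∈ = parity⇒even w (proj₁ (∈-evenExtension⁻ P w w∈))

  atLeast4 : ∀ w → Member (codeOver K E) w → w ≢ 0w → ∀ k → weight w ≡ k → 2 ∣ k → 4 ≤ k
  -- Being nonzero excludes weight 0, evenness excludes 1 and 3, and avoiding the bad classes
  -- excludes 2.
  atLeast4 w w∈ w≢0 0 eq _ = contradiction (weight≡0⇒≡0w w eq) w≢0
  atLeast4 w w∈ w≢0 1 eq 2∣1 with () ← ∣1⇒≡1 2∣1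
  atLeast4 w w∈ w≢0 2 eq _
    with () ← trans (sym (bad⁺ K w eq)) (av _ (trans (sym (check-compose K E (tail w)))
                (∈⟦⟧⇒ (compose K E) (proj₂ (∈-evenExtension⁻ P w w∈)))))
  atLeast4 w w∈ w≢0 3 eq 2∣3 with () ← ∣1⇒≡1 (∣m+n∣m⇒∣n 2∣3 (divides 1 refl))
  atLeast4 w w∈ w≢0 (suc (suc (suc (suc k)))) eq _ = s≤s (s≤s (s≤s (s≤s z≤n)))

-- Containing the code of `K`, the code `S` is a union of its classes and is described by its image
-- `T` in Z₂ᵐ. A bad class in `T` would put a word of weight 2 into `S`.
classify : ∀ {ℓ m} (K : Ech ℓ m) (S : Code (suc ℓ)) → IsQuadCode S →
           (∀ w → Member (evenExtension ⟦ K ⟧) w → Member S w) →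
           ∃₂ λ e (E : Ech m e) → E ∈ echelons (bad K) e × S ≗ codeOver K E
classify {ℓ} K S (S-sub@(0∈S , S-⊕) , S-even , S-wt) K⊆S =
  let e , E , T≗E = echelon T T-sub in e , E , ∈-echelons⁺ (bad K) E (avoids E T≗E) , S≗ E T≗E
  where
  open ≡-Reasoning

  T : Code _
  T v = S (extend (section K v))

  lift-linear : Linear (extend ∘ section K)
  lift-linear v w = trans (cong extend (section-linear K v w)) (extend-linear (section K v) (section K w))

  T-sub : IsSubspace T
  T-sub = subst (Member S) (sym (linear-0 {h = extend ∘ section K} lift-linear)) 0∈S ,
          λ u v u∈ v∈ → subst (Member S) (sym (lift-linear u v)) (S-⊕ _ _ u∈ v∈)

  S-extend : ∀ w → S (extend w) ≡ T (check K w)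
  -- `w` and its representative `s` have the same syndrome, so the extension of their sum lies in
  -- the code of `K`, hence in `S`.
  S-extend w = congruent S-sub (subst (Member S) (extend-linear w s)
    (K⊆S (extend (w ⊕ s)) (trans (evenExtension-extend ⟦ K ⟧ (w ⊕ s)) (⇒∈⟦⟧ K (begin
      check K (w ⊕ s)         ≡⟨ check-linear K w s ⟩
      check K w ⊕ check K s   ≡⟨ ≡⇒⊕≡0 (sym (check-section K (check K w))) ⟩
      0w                      ∎)))))
    where s = section K (check K w)

  module _ {e} (E : Ech _ e) (T≗E : T ≗ ⟦ E ⟧) where
    S≗ : S ≗ codeOver K E
    S≗ w = begin
      S w                                            ≡⟨ puncture-evenExtension S S-even w ⟩
      not (parity w) ∧ S (extend (tail w))           ≡⟨ cong (not (parity w) ∧_) (S-extend (tail w)) ⟩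
      not (parity w) ∧ T (check K (tail w))          ≡⟨ cong (not (parity w) ∧_) (T≗E _) ⟩
      not (parity w) ∧ ⟦ E ⟧ (check K (tail w))      ≡⟨ cong (not (parity w) ∧_) (⟦compose⟧ K E (tail w)) ⟨
      codeOver K E w                                 ∎

    avoids : Avoids (bad K) E
    avoids v v∈E = ¬-not λ v∈bad →
      let w , w≡2 , v≡ = bad⁻ K v v∈bad
          w∈ : Member (codeOver K E) w
          w∈ = ∈-evenExtension⁺ ⟦ compose K E ⟧ w (even⇒parity w (subst (2 ∣_) (sym w≡2) (divides 1 refl)))
                 (⇒∈⟦⟧ (compose K E) (trans (check-compose K E (tail w)) (trans (cong (check E) (sym v≡)) v∈E)))
          4≤2 = subst (4 ≤_) w≡2 (S-wt w (trans (S≗ w) w∈)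
                  λ w≡0 → contradiction (trans (sym (weight-0w (suc ℓ))) (trans (cong weight (sym w≡0)) w≡2)) λ ())
      in contradiction 4≤2 λ { (s≤s (s≤s ())) }

codeOver-hasDim : ∀ {ℓ m e} (K : Ech ℓ m) (E : Ech m e) → ∃[ k ] (HasDim (codeOver K E) k × k + e ≡ ℓ)
codeOver-hasDim K E =
  dim (compose K E) , evenExtension-hasDim (⟦⟧-hasDim (compose K E)) , dim+codim (compose K E)

Spans : ∀ {ℓ m} → (Word (suc ℓ) → Set) → Ech ℓ m → Set
Spans G K = ∀ w → Span G w ⇔ Member (evenExtension ⟦ K ⟧) w

lookup-unique : ∀ {A : Set} {xs : List A} → Unique xs → ∀ i j → List.lookup xs i ≡ List.lookup xs j → i ≡ j
lookup-unique (_ ∷ _)    zero    zero    _  = refl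
lookup-unique (x∉ ∷ _)   zero    (suc j) eq = contradiction eq (All.lookup x∉ (∈-lookup j))
lookup-unique (x∉ ∷ _)   (suc i) zero    eq = contradiction (sym eq) (All.lookup x∉ (∈-lookup i))
lookup-unique (_ ∷ uniq) (suc i) (suc j) eq = cong suc (lookup-unique uniq i j eq)

numberOf : ∀ {A : Set} {ℓ} {P : Code ℓ → Set} (xs : List A) (code : A → Code ℓ) → Unique xs →
           (∀ {x y} → code x ≗ code y → x ≡ y) → (∀ {x} → x ∈ xs → P (code x)) →
           (∀ S → P S → ∃[ x ] (x ∈ xs × S ≗ code x)) → NumberOf (length xs) P
numberOf {P = P} xs code uniq inj sound complete =
    tabulate codes
  , (λ i → subst P (sym (lookup∘tabulate codes i)) (sound (∈-lookup i)))
  , (λ i j eq → lookup-unique uniq i j (inj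
      (subst₂ _≗_ (lookup∘tabulate codes i) (lookup∘tabulate codes j) eq)))
  , λ S S∈P →
      let x , x∈ , S≗ = complete S S∈P
          i = index x∈
      in i , λ w → trans (S≗ w) (cong (_$ w)
           (trans (cong code (lookup-index x∈)) (sym (lookup∘tabulate codes i))))
  where
  codes : Fin (length xs) → Code _
  codes = code ∘ List.lookup xs

-- Every codimension is counted, including those with count 0, from which `4≤codim` derives the
-- upper bound on the dimension.
Counts : ∀ {m} → Trie m → Vec ℕ (suc m) → Set
Counts t ns = ∀ e → length (echelons t (toℕ e)) ≡ lookup ns e

counts? : ∀ {m} (t : Trie m) (ns : Vec ℕ (suc m)) → Dec (Counts t ns)
counts? t ns = Finₚ.all? λ e → length (echelons t (toℕ e)) ℕ.≟ lookup ns e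

module _ {ℓ m} (K : Ech ℓ m) {G : Word (suc ℓ) → Set} (G-spans : Spans G K) where

  classify-containing : ∀ S → IsQuadCode S × Contains G S →
    ∃₂ λ e (E : Ech m e) → E ∈ echelons (bad K) e × S ≗ codeOver K E
  classify-containing S (S-quad , G⊆S) = classify K S S-quad λ w → G⊆S w ∘ from (G-spans w)

  containing-hasDim : ∀ S → IsQuadCode S × Contains G S →
    ∃₂ λ k e → HasDim S k × k + e ≡ ℓ × e ≤ m × ∃[ E ] E ∈ echelons (bad K) e
  containing-hasDim S S∈ =
    let e , E , E∈ , S≗ = classify-containing S S∈
        k , E-dim , k+e = codeOver-hasDim K E
    in k , e , hasDim-resp (sym ∘ S≗) E-dim , k+e , codim≤ E , E , E∈

  numberOf-containing : ∀ ns → Counts (bad K) ns → ∀ i k → k + toℕ i ≡ ℓ →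
    NumberOf (lookup ns i) (λ S → (IsQuadCode S × Contains G S) × HasDim S k)
  numberOf-containing ns counts i k k+e≡ℓ = subst (λ N → NumberOf N _) (counts i)
    (numberOf (echelons (bad K) e) (codeOver K) (echelons-unique (bad K) e) (codeOver-injective K)
      sound complete)
    where
    e = toℕ i

    sound : ∀ {E} → E ∈ echelons (bad K) e →
            (IsQuadCode (codeOver K E) × Contains G (codeOver K E)) × HasDim (codeOver K E) k
    sound {E} E∈ =
      let k′ , E-dim , k′+e = codeOver-hasDim K E in
      (avoids⇒isQuadCode K E (∈-echelons⁻ (bad K) E∈) , λ w → codeOver-⊇ K E w ∘ to (G-spans w)) ,
      subst (HasDim (codeOver K E)) (+-cancelʳ-≡ e k′ k (trans k′+e (sym k+e≡ℓ))) E-dim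

    -- The classification yields a codimension only provably equal to `e`; matching on the equation
    -- moves the echelon form to `e`.
    at-codim : ∀ {S e′} → e′ ≡ e → (E : Ech m e′) → E ∈ echelons (bad K) e′ → S ≗ codeOver K E →
               ∃[ F ] (F ∈ echelons (bad K) e × S ≗ codeOver K F)
    at-codim refl E E∈ S≗ = E , E∈ , S≗

    complete : ∀ S → (IsQuadCode S × Contains G S) × HasDim S k →
               ∃[ E ] (E ∈ echelons (bad K) e × S ≗ codeOver K E)
    complete S (S∈@((S-sub , _) , _) , S-dim) =
      let e′ , E , E∈ , S≗ = classify-containing S S∈
          k′ , E-dim , k′+e′ = codeOver-hasDim K E
          k≡k′ = hasDim-unique S-sub S-dim (hasDim-resp (sym ∘ S≗) E-dim)
      in at-codim (+-cancelˡ-≡ k e′ e (trans (cong (_+ e′) k≡k′) (trans k′+e′ (sym k+e≡ℓ)))) E E∈ S≗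

-- Realizability

unit : ∀ {n} → Fin n → Word n
unit zero    = true ∷ 0w
unit (suc i) = false ∷ unit i

-- A linear map is determined by its values on the unit words; hence the linear dependencies among
-- the cards `h (unit i)` are exactly the kernel of `h`.
lincomb-unit : ∀ {m n} {h : Word m → Word n} → Linear h → ∀ c → lincomb c (tabulate (h ∘ unit)) ≡ h c
lincomb-unit         h-lin []          = sym (linear-0 h-lin)
lincomb-unit         h-lin (false ∷ c) = lincomb-unit (λ v w → h-lin (false ∷ v) (false ∷ w)) c
lincomb-unit {h = h} h-lin (true ∷ c)  = begin
  h (true ∷ 0w) ⊕ lincomb c (tabulate (h ∘ (false ∷_) ∘ unit))
    ≡⟨ cong (h (true ∷ 0w) ⊕_) (lincomb-unit (λ v w → h-lin (false ∷ v) (false ∷ w)) c) ⟩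
  h (true ∷ 0w) ⊕ h (false ∷ c)
    ≡⟨ h-lin (true ∷ 0w) (false ∷ c) ⟨
  h (true ∷ (0w ⊕ c))
    ≡⟨ cong (h ∘ (true ∷_)) (⊕-identityˡ c) ⟩
  h (true ∷ c) ∎
  where open ≡-Reasoning

weight-unit : ∀ {n} (i : Fin n) → weight (unit i) ≡ 1
weight-unit {suc n} zero    = cong suc (weight-0w n)
weight-unit         (suc i) = weight-unit i

weight-unit⊕unit : ∀ {n} {i j : Fin n} → i ≢ j → weight (unit i ⊕ unit j) ≡ 2
weight-unit⊕unit {i = zero}  {zero}  i≢j = contradiction refl i≢j
weight-unit⊕unit {i = zero}  {suc j} _   = cong suc (trans (cong weight (⊕-identityˡ (unit j))) (weight-unit j))
weight-unit⊕unit {i = suc i} {zero}  _   = cong suc (trans (cong weight (⊕-identityʳ (unit i))) (weight-unit i))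
weight-unit⊕unit {i = suc i} {suc j} i≢j = weight-unit⊕unit (i≢j ∘ cong suc)

-- Keeps the cards of a realization distinct: two equal cards would put this word of weight 2 into
-- the code.
unit⊕unit∉quadCode : ∀ {n} {S : Code n} → IsQuadCode S → ∀ {i j} → i ≢ j → ¬ Member S (unit i ⊕ unit j)
unit⊕unit∉quadCode {n} (_ , _ , S-wt) {i} {j} i≢j w∈S =
  contradiction (subst (4 ≤_) w≡2 (S-wt (unit i ⊕ unit j) w∈S w≢0)) λ { (s≤s (s≤s ())) }
  where
  w≡2 : weight (unit i ⊕ unit j) ≡ 2
  w≡2 = weight-unit⊕unit i≢j

  w≢0 : unit i ⊕ unit j ≢ 0w
  w≢0 w≡0 = contradiction (trans (sym w≡2) (trans (cong weight w≡0) (weight-0w n))) λ ()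

-- Embeds Z₂ᵐ into a possibly larger deck; being linear and injective, it leaves kernels unchanged.
pad : ∀ {m n} → m ≤ n → Word m → Word n
pad z≤n     []      = 0w
pad (s≤s p) (x ∷ w) = x ∷ pad p w

pad-linear : ∀ {m n} (p : m ≤ n) → Linear (pad p)
pad-linear z≤n     []      []      = sym (⊕-self 0w)
pad-linear (s≤s p) (x ∷ v) (y ∷ w) = cong (_ ∷_) (pad-linear p v w)

pad≡0⇒≡0 : ∀ {m n} (p : m ≤ n) w → pad p w ≡ 0w → w ≡ 0w
pad≡0⇒≡0 z≤n     []      _  = refl
pad≡0⇒≡0 (s≤s p) (x ∷ w) eq = cong₂ _∷_ (∷-injectiveˡ eq) (pad≡0⇒≡0 p w (∷-injectiveʳ eq))

-- Even words inject into S × Z₂ⁿ, by their image under the card map and their difference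
-- from a representative of the fibre.
realizable⇒≤ : ∀ {ℓ n k} {S : Code (suc ℓ)} → HasDim S k → Realizable n S → ℓ ≤ k + n
realizable⇒≤ {S = S} (b , _ , _ , spn) (a , _ , a-realizes) =
  word-injective⇒≤ (λ w → proj₁ (coords w) Vec.++ A w) λ {v} {w} eq →
    let cv≡cw , Av≡Aw = ++-injective (proj₁ (coords v)) (proj₁ (coords w)) eq in
    ∷-injectiveʳ (⊕-cancelʳ (extend v) (extend w) (extend (repr (A v))) (begin
      extend v ⊕ extend (repr (A v))  ≡⟨ proj₂ (coords v) ⟨
      lincomb (proj₁ (coords v)) b    ≡⟨ cong (λ c → lincomb c b) cv≡cw ⟩
      lincomb (proj₁ (coords w)) b    ≡⟨ proj₂ (coords w) ⟩
      extend w ⊕ extend (repr (A w))  ≡⟨ cong (λ y → extend w ⊕ extend (repr y)) Av≡Aw ⟨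
      extend w ⊕ extend (repr (A v))  ∎))
  where
  open ≡-Reasoning

  A : Word _ → Word _
  A w = lincomb (extend w) a

  preimage? : ∀ y → Dec (∃[ w ] A w ≡ y)
  preimage? y = ∃? λ w → A w ≟ʷ y

  repr : Word _ → Word _
  repr y with preimage? y
  ... | yes (w , _) = w
  -- An arbitrary default: `A-repr` shows that the search succeeds at every value of `A`.
  ... | no  _       = 0w

  A-repr : ∀ w → A (repr (A w)) ≡ A w
  A-repr w with preimage? (A w)
  ... | yes (_ , eq) = eq
  ... | no  ∄        = contradiction (w , refl) ∄

  coords : ∀ w → ∃[ c ] lincomb c b ≡ extend w ⊕ extend (repr (A w))
  coords w = spn _ (from (a-realizes _)
    ( parity⇒even (extend w ⊕ extend r) (trans (parity-⊕ (extend w) (extend r))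
        (cong₂ _xor_ (xor-same (parity w)) (xor-same (parity r))))
    , trans (lincomb-⊕ (extend w) (extend r) a) (≡⇒⊕≡0 (sym (A-repr w)))))
    where r = repr (A w)

≤⇒realizable : ∀ {ℓ n k} {S : Code (suc ℓ)} → IsQuadCode S → HasDim S k → ℓ ≤ k + n → Realizable n S
≤⇒realizable {ℓ} {n} {k} {S} S-quad@(S-sub@(0∈S , S-⊕) , S-even , _) S-dim ℓ≤k+n =
  let e , E , P≗E = echelon (S ∘ extend)
        ( subst (Member S) (sym (linear-0 {h = extend} extend-linear)) 0∈S
        , λ u v u∈ v∈ → subst (Member S) (sym (extend-linear u v)) (S-⊕ _ _ u∈ v∈))
  in realize E P≗E
  where
  open ≡-Reasoning

  module _ {e} (E : Ech ℓ e) (P≗E : S ∘ extend ≗ ⟦ E ⟧) where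
    S≗ : S ≗ evenExtension ⟦ E ⟧
    S≗ w = trans (puncture-evenExtension S S-even w) (cong (not (parity w) ∧_) (P≗E (tail w)))

    -- Uniqueness of dimension gives `k + e ≡ ℓ`, so the hypothesis says exactly that the syndromes
    -- fit into Z₂ⁿ.
    e≤n : e ≤ n
    e≤n = +-cancelˡ-≤ k e n (≤-trans (≤-reflexive (trans
      (cong (_+ e) (hasDim-unique S-sub S-dim
        (hasDim-resp (sym ∘ S≗) (evenExtension-hasDim (⟦⟧-hasDim E)))))
      (dim+codim E))) ℓ≤k+n)

    -- The first unit word has zero tail, so the first card is `0w`. On even words the dropped bit
    -- is determined by the tail, and there the kernel of `h` is `S`.
    h : Word (suc ℓ) → Word n
    h w = pad e≤n (check E (tail w))

    h-linear : Linear h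
    h-linear v@(_ ∷ _) w@(_ ∷ _) =
      trans (cong (pad e≤n) (check-linear E (tail v) (tail w))) (pad-linear e≤n _ _)

    even∧h≡0⇒∈S : ∀ w → parity w ≡ false → h w ≡ 0w → Member S w
    even∧h≡0⇒∈S w even hw≡0 = trans (S≗ w)
      (∈-evenExtension⁺ ⟦ E ⟧ w even (⇒∈⟦⟧ E (pad≡0⇒≡0 e≤n _ hw≡0)))

    sound : ∀ c → Member S c → 2 ∣ weight c × lincomb c (tabulate (h ∘ unit)) ≡ 0w
    sound c c∈S = S-even c c∈S , (begin
      lincomb c (tabulate (h ∘ unit))  ≡⟨ lincomb-unit h-linear c ⟩
      pad e≤n (check E (tail c))       ≡⟨ cong (pad e≤n) (∈⟦⟧⇒ E (proj₂
                                            (∈-evenExtension⁻ ⟦ E ⟧ c (trans (sym (S≗ c)) c∈S)))) ⟩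
      pad e≤n 0w                       ≡⟨ linear-0 (pad-linear e≤n) ⟩
      0w                               ∎)

    complete : ∀ c → 2 ∣ weight c × lincomb c (tabulate (h ∘ unit)) ≡ 0w → Member S c
    complete c (even , eq) =
      even∧h≡0⇒∈S c (even⇒parity c even) (trans (sym (lincomb-unit h-linear c)) eq)

    distinct : ∀ i j → lookup (tabulate (h ∘ unit)) i ≡ lookup (tabulate (h ∘ unit)) j → i ≡ j
    distinct i j eq = decidable-stable (i Finₚ.≟ j) λ i≢j →
      unit⊕unit∉quadCode S-quad i≢j (even∧h≡0⇒∈S (unit i ⊕ unit j)
        (even⇒parity (unit i ⊕ unit j) (subst (2 ∣_) (sym (weight-unit⊕unit i≢j)) (divides 1 refl)))
        (trans (h-linear (unit i) (unit j)) (≡⇒⊕≡0 (trans (sym (lookup∘tabulate (h ∘ unit) i))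
          (trans eq (lookup∘tabulate (h ∘ unit) j))))))

    realize : Realizable n S
    realize = tabulate (h ∘ unit) , distinct , λ c → mk⇔ (sound c) (complete c)

-- The three families

pattern O = false
pattern I = true

-- C_s, C_m and C_sm, punctured at the first position.
Kₛ : Ech 15 8
Kₛ = pivot (I ∷ I ∷ O ∷ I ∷ I ∷ O ∷ I ∷ I ∷ [])
   $ pivot (I ∷ O ∷ O ∷ I ∷ O ∷ O ∷ I ∷ O ∷ [])
   $ pivot (O ∷ I ∷ O ∷ O ∷ I ∷ O ∷ O ∷ I ∷ [])
   $ pivot (O ∷ O ∷ I ∷ I ∷ I ∷ I ∷ I ∷ I ∷ [])
   $ pivot (I ∷ I ∷ I ∷ I ∷ I ∷ I ∷ I ∷ I ∷ [])
   $ skip $ skip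
   $ pivot (I ∷ I ∷ I ∷ O ∷ O ∷ O ∷ [])
   $ skip $ skip $ skip
   $ pivot (I ∷ I ∷ I ∷ [])
   $ skip $ skip $ skip []

Kₘ : Ech 15 7
Kₘ = pivot (O ∷ I ∷ I ∷ O ∷ I ∷ O ∷ I ∷ [])
   $ pivot (I ∷ I ∷ I ∷ I ∷ I ∷ O ∷ O ∷ [])
   $ pivot (I ∷ O ∷ O ∷ I ∷ O ∷ O ∷ I ∷ [])
   $ pivot (O ∷ I ∷ I ∷ I ∷ I ∷ I ∷ I ∷ [])
   $ pivot (O ∷ O ∷ I ∷ O ∷ O ∷ O ∷ I ∷ [])
   $ pivot (I ∷ I ∷ O ∷ I ∷ I ∷ I ∷ O ∷ [])
   $ skip
   $ pivot (I ∷ I ∷ I ∷ O ∷ O ∷ O ∷ [])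
   $ skip $ skip $ skip
   $ pivot (I ∷ I ∷ I ∷ [])
   $ skip $ skip $ skip []

Kₛₘ : Ech 15 4
Kₛₘ = pivot (O ∷ O ∷ I ∷ I ∷ [])
    $ pivot (O ∷ I ∷ O ∷ I ∷ [])
    $ pivot (O ∷ I ∷ I ∷ O ∷ [])
    $ pivot (I ∷ O ∷ O ∷ I ∷ [])
    $ pivot (I ∷ O ∷ I ∷ O ∷ [])
    $ pivot (I ∷ I ∷ O ∷ O ∷ [])
    $ pivot (I ∷ I ∷ I ∷ I ∷ [])
    $ pivot (I ∷ I ∷ I ∷ O ∷ [])
    $ pivot (I ∷ I ∷ O ∷ I ∷ [])
    $ pivot (I ∷ O ∷ I ∷ I ∷ [])
    $ skip
    $ pivot (I ∷ I ∷ I ∷ [])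
    $ skip $ skip $ skip []

-- Comparison of the echelon forms with the given generators.

span-⊕ : ∀ {n} {G : Word n → Set} {v w} → Span G v → Span G w → Span G (v ⊕ w)
span-⊕ {G = G} {w = w} span-0 w∈ = subst (Span G) (sym (⊕-identityˡ w)) w∈
span-⊕ {G = G} {w = w} (span-+ {g} {v} g∈ v∈) w∈ =
  subst (Span G) (sym (⊕-assoc g v w)) (span-+ g∈ (span-⊕ v∈ w∈))

lincomb-span : ∀ {n k} {G : Word n → Set} (b : Vec (Word n) k) → (∀ i → Span G (lookup b i)) →
               ∀ c → Span G (lincomb c b)
lincomb-span []      _  []          = span-0
lincomb-span (w ∷ b) b∈ (false ∷ c) = lincomb-span b (b∈ ∘ suc) c
lincomb-span (w ∷ b) b∈ (true ∷ c)  = span-⊕ (b∈ zero) (lincomb-span b (b∈ ∘ suc) c)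

span⇒member : ∀ {n} {G : Word n → Set} {S : Code n} → IsSubspace S → (∀ {g} → G g → Member S g) →
              ∀ {w} → Span G w → Member S w
span⇒member (0∈S , _)     G⊆S span-0          = 0∈S
span⇒member S-sub@(_ , S-⊕) G⊆S (span-+ g∈ w∈) = S-⊕ _ _ (G⊆S g∈) (span⇒member S-sub G⊆S w∈)

basisWord : ∀ {ℓ m} (K : Ech ℓ m) → Fin (dim K) → Word (suc ℓ)
basisWord K i = extend (lookup (basis K) i)

Generated : ∀ {ℓ m r} → Ech ℓ m → Vec (Word (suc ℓ)) r → Set
Generated K gs = ∀ i → ∃[ c ] lincomb c gs ≡ basisWord K i

generated? : ∀ {ℓ m r} (K : Ech ℓ m) (gs : Vec (Word (suc ℓ)) r) → Dec (Generated K gs)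
generated? K gs = Finₚ.all? λ i → ∃? λ c → lincomb c gs ≟ʷ basisWord K i

-- One inclusion is tested on the generators. For the other, `gs` is a short list of generators in
-- which every basis word of `K` is expressed by a finite search.
generated⇒spans : ∀ {ℓ m r} (K : Ech ℓ m) {G : Word (suc ℓ) → Set} →
                  (∀ {g} → G g → Member (evenExtension ⟦ K ⟧) g) →
                  (gs : Vec (Word (suc ℓ)) r) → (∀ i → G (lookup gs i)) → Generated K gs → Spans G K
generated⇒spans K {G} G⊆K gs gs∈G gen w =
  mk⇔ (span⇒member (evenExtension-isSubspace (⟦⟧-isSubspace K)) G⊆K) λ w∈ →
    let b , _ , _ , spn = evenExtension-hasDim (⟦⟧-hasDim K)
        c , eq = spn w w∈
    in subst (Span G) eq (lincomb-span b b∈ c)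
  where
  g∈ : ∀ i → Span G (lookup gs i)
  g∈ i = subst (Span G) (⊕-identityʳ _) (span-+ (gs∈G i) span-0)

  b∈ : ∀ i → Span G (lookup (Vec.map extend (basis K)) i)
  b∈ i = let c , eq = gen i in
    subst (Span G) (trans eq (sym (lookup-map i extend (basis K)))) (lincomb-span gs g∈ c)

lines : Vec (Word 16) 8
lines = tabulate ([ rowWord , colWord ]′ ∘ Fin.splitAt 4)

linesₘ : Vec (Word 16) 10
linesₘ = diagWord ∷ antidiagWord ∷ lines

lines∈GenS : ∀ i → GenS (lookup lines i)
lines∈GenS i = subst GenS (sym (lookup∘tabulate ([ rowWord , colWord ]′ ∘ Fin.splitAt 4) i)) line∈GenS
  where
  line∈GenS : GenS ([ rowWord , colWord ]′ (Fin.splitAt 4 i))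
  line∈GenS with Fin.splitAt 4 i
  ... | inj₁ r = inj₁ (r , refl)
  ... | inj₂ c = inj₂ (c , refl)

lines⊆ : ∀ {m} (K : Ech 15 m) →
         (∀ r → Member (evenExtension ⟦ K ⟧) (rowWord r)) →
         (∀ c → Member (evenExtension ⟦ K ⟧) (colWord c)) →
         ∀ {g} → GenS g → Member (evenExtension ⟦ K ⟧) g
lines⊆ K rows cols (inj₁ (r , refl)) = rows r
lines⊆ K rows cols (inj₂ (c , refl)) = cols c

members? : ∀ {m r} (K : Ech 15 m) (g : Fin r → Word 16) →
           Dec (∀ i → Member (evenExtension ⟦ K ⟧) (g i))
members? K g = Finₚ.all? λ i → evenExtension ⟦ K ⟧ (g i) Bool.≟ true

GenS-spans : Spans GenS Kₛ
GenS-spans = generated⇒spans Kₛ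
  (lines⊆ Kₛ (toWitness {a? = members? Kₛ rowWord} _) (toWitness {a? = members? Kₛ colWord} _))
  lines lines∈GenS (toWitness {a? = generated? Kₛ lines} _)

GenM-spans : Spans GenM Kₘ
GenM-spans = generated⇒spans Kₘ
  (λ { (inj₁ g∈)          → lines⊆ Kₘ (toWitness {a? = members? Kₘ rowWord} _)
                                      (toWitness {a? = members? Kₘ colWord} _) g∈
     ; (inj₂ (inj₁ refl)) → refl
     ; (inj₂ (inj₂ refl)) → refl })
  linesₘ
  (λ { zero          → inj₂ (inj₁ refl)
     ; (suc zero)    → inj₂ (inj₂ refl)
     ; (suc (suc i)) → inj₁ (lines∈GenS i) })
  (toWitness {a? = generated? Kₘ linesₘ} _)

Distinct : (p q r s : Fin 16) → Set
Distinct p q r s = p ≢ q × p ≢ r × p ≢ s × q ≢ r × q ≢ s × r ≢ s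

IsQuad : (p q r s : Fin 16) → Set
IsQuad p q r s = Distinct p q r s × (posVec p ⊕ posVec q ⊕ posVec r ⊕ posVec s ≡ 0w)

distinct? : ∀ p q r s → Dec (Distinct p q r s)
distinct? p q r s =
  ¬? (p Finₚ.≟ q) ×-dec ¬? (p Finₚ.≟ r) ×-dec ¬? (p Finₚ.≟ s) ×-dec
  ¬? (q Finₚ.≟ r) ×-dec ¬? (q Finₚ.≟ s) ×-dec ¬? (r Finₚ.≟ s)

-- The sum is tested first because it is 0w for only one in sixteen of the 65536 tuples.
quads⊆? : Dec (∀ p q r s → posVec p ⊕ posVec q ⊕ posVec r ⊕ posVec s ≡ 0w → Distinct p q r s →
               Member (evenExtension ⟦ Kₛₘ ⟧) (indicator4 p q r s))
quads⊆? = Finₚ.all? λ p → Finₚ.all? λ q → Finₚ.all? λ r → Finₚ.all? λ s →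
  (posVec p ⊕ posVec q ⊕ posVec r ⊕ posVec s ≟ʷ 0w) →-dec distinct? p q r s →-dec
  (evenExtension ⟦ Kₛₘ ⟧ (indicator4 p q r s) Bool.≟ true)

quads⊆ : ∀ p q r s → posVec p ⊕ posVec q ⊕ posVec r ⊕ posVec s ≡ 0w → Distinct p q r s →
         Member (evenExtension ⟦ Kₛₘ ⟧) (indicator4 p q r s)
quads⊆ = toWitness {a? = quads⊆?} _

-- Eleven quads through position 0 that span `C_sm`, as many as its dimension, which bounds the
-- search in `generated?` to 2¹¹ combinations per basis word.
quadPositions : Vec (Fin 16 × Fin 16 × Fin 16 × Fin 16) 11
quadPositions =
  (# 0 , # 1 , # 2  , # 3)  ∷ (# 0 , # 1 , # 4  , # 5)  ∷ (# 0 , # 1 , # 6  , # 7)  ∷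
  (# 0 , # 1 , # 8  , # 9)  ∷ (# 0 , # 1 , # 10 , # 11) ∷ (# 0 , # 1 , # 12 , # 13) ∷
  (# 0 , # 1 , # 14 , # 15) ∷ (# 0 , # 2 , # 4  , # 6)  ∷ (# 0 , # 2 , # 8  , # 10) ∷
  (# 0 , # 2 , # 12 , # 14) ∷ (# 0 , # 4 , # 8  , # 12) ∷ []

indicator : Fin 16 × Fin 16 × Fin 16 × Fin 16 → Word 16
indicator (p , q , r , s) = indicator4 p q r s

quads : Vec (Word 16) 11
quads = Vec.map indicator quadPositions

quadPositions-areQuads : ∀ i → let p , q , r , s = lookup quadPositions i in IsQuad p q r s
quadPositions-areQuads = toWitness {a? = Finₚ.all? λ i → let p , q , r , s = lookup quadPositions i in
  distinct? p q r s ×-dec (posVec p ⊕ posVec q ⊕ posVec r ⊕ posVec s ≟ʷ 0w)} _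

GenSM-spans : Spans GenSM Kₛₘ
GenSM-spans = generated⇒spans Kₛₘ
  (λ { (p , q , r , s , pqrs , sum≡0 , refl) → quads⊆ p q r s sum≡0 pqrs })
  quads
  (λ i → let p , q , r , s = lookup quadPositions i
             pqrs , sum≡0 = quadPositions-areQuads i
         in p , q , r , s , pqrs , sum≡0 , lookup-map i indicator quadPositions)
  (toWitness {a? = generated? Kₛₘ quads} _)

-- The counts are indexed by the codimension e in Word 15, so the dimension is 15 − e.
Nₛ : Vec ℕ 9
Nₛ = 0 ∷ 0 ∷ 0 ∷ 0 ∷ 112 ∷ 2823 ∷ 2531 ∷ 159 ∷ 1 ∷ []

countsₛ : Counts (bad Kₛ) Nₛ
countsₛ = toWitness {a? = counts? (bad Kₛ) Nₛ} _

Nₘ : Vec ℕ 8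
Nₘ = 0 ∷ 0 ∷ 0 ∷ 0 ∷ 10 ∷ 85 ∷ 43 ∷ 1 ∷ []

countsₘ : Counts (bad Kₘ) Nₘ
countsₘ = toWitness {a? = counts? (bad Kₘ) Nₘ} _

-- Every nonzero class of Z₂⁴ is bad, so only the zero subspace remains, and it corresponds to
-- `C_sm` itself.
Nₛₘ : Vec ℕ 5
Nₛₘ = 0 ∷ 0 ∷ 0 ∷ 0 ∷ 1 ∷ []

countsₛₘ : Counts (bad Kₛₘ) Nₛₘ
countsₛₘ = toWitness {a? = counts? (bad Kₛₘ) Nₛₘ} _

-- Dimension bounds and conclusion.

∈⇒length≢0 : ∀ {A : Set} {x : A} {xs} → x ∈ xs → length xs ≢ 0
∈⇒length≢0 (here _)  ()
∈⇒length≢0 (there _) ()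

-- The four leading zeros in the counts leave no avoiding subspace of codimension below 4.
4≤codim : ∀ {j} (t : Trie (3 + j)) ns → Counts t (0 ∷ 0 ∷ 0 ∷ 0 ∷ ns) →
          ∀ {e} {E : Ech (3 + j) e} → E ∈ echelons t e → 4 ≤ e
4≤codim t ns counts {0} E∈ = contradiction (counts (# 0)) (∈⇒length≢0 E∈)
4≤codim t ns counts {1} E∈ = contradiction (counts (# 1)) (∈⇒length≢0 E∈)
4≤codim t ns counts {2} E∈ = contradiction (counts (# 2)) (∈⇒length≢0 E∈)
4≤codim t ns counts {3} E∈ = contradiction (counts (# 3)) (∈⇒length≢0 E∈)
4≤codim t ns counts {suc (suc (suc (suc e)))} E∈ = s≤s (s≤s (s≤s (s≤s z≤n)))

-- As `k + e ≡ 15`, the lower bound on `k` comes from `e ≤ m`, the codimension of the contained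
-- code, and the upper bound from `4 ≤ e`.
dimension-range : ∀ {j} (K : Ech 15 (3 + j)) {G} → Spans G K → ∀ ns → Counts (bad K) (0 ∷ 0 ∷ 0 ∷ 0 ∷ ns) →
                  ∀ l → l + (3 + j) ≡ 15 →
                  ∀ S → IsQuadCode S × Contains G S → ∃[ k ] (HasDim S k × l ≤ k × k ≤ 11)
dimension-range {j} K G-spans ns counts l l+m≡15 S S∈ =
  let k , e , S-dim , k+e≡15 , e≤m , _ , E∈ = containing-hasDim K G-spans S S∈ in
  k , S-dim
  , +-cancelʳ-≤ (3 + j) l k (≤-trans (≤-reflexive (trans l+m≡15 (sym k+e≡15))) (+-monoʳ-≤ k e≤m))
  , +-cancelʳ-≤ 4 k 11 (≤-trans (+-monoʳ-≤ k (4≤codim (bad K) ns counts E∈)) (≤-reflexive k+e≡15))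

numberOf-forget : ∀ {ℓ N} {P Q : Code ℓ → Set} → (∀ S → P S → Q S) →
                  NumberOf N (λ S → P S × Q S) → NumberOf N P
numberOf-forget P⇒Q (L , sound , inj , complete) =
  L , proj₁ ∘ sound , inj , λ S S∈P → complete S (S∈P , P⇒Q S S∈P)

stronglyMagic-hasDim : ∀ S → StronglyMagicCode S → HasDim S 11
stronglyMagic-hasDim S S∈ =
  -- `C_sm` already has dimension 11 = 15 - 4, so the two bounds meet.
  let k , S-dim , 11≤k , k≤11 = dimension-range Kₛₘ GenSM-spans (Vec.drop 4 Nₛₘ) countsₛₘ 11 refl S S∈
  in subst (HasDim S) (≤-antisym k≤11 11≤k) S-dim

theorem12 : (∀ S → SemimagicCode S → ∃[ k ] (HasDim S k × 7 ≤ k × k ≤ 11))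
    × NumberOf 1 (λ S → SemimagicCode S × HasDim S 7)
    × NumberOf 159 (λ S → SemimagicCode S × HasDim S 8)
    × NumberOf 2531 (λ S → SemimagicCode S × HasDim S 9)
    × NumberOf 2823 (λ S → SemimagicCode S × HasDim S 10)
    × NumberOf 112 (λ S → SemimagicCode S × HasDim S 11)
    × (∀ S → MagicCode S → ∃[ k ] (HasDim S k × 8 ≤ k × k ≤ 11))
    × NumberOf 1 (λ S → MagicCode S × HasDim S 8)
    × NumberOf 43 (λ S → MagicCode S × HasDim S 9)
    × NumberOf 85 (λ S → MagicCode S × HasDim S 10)
    × NumberOf 10 (λ S → MagicCode S × HasDim S 11)
    × NumberOf 1 StronglyMagicCode
    × (∀ S → StronglyMagicCode S → HasDim S 11)
    × (∀ S k → (SemimagicCode S ⊎ MagicCode S ⊎ StronglyMagicCode S)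
    → HasDim S k → 7 ≤ k → k ≤ 11
    → ∀ n → (Realizable n S ⇔ 15 ≤ k + n))
theorem12 =
    dimension-range Kₛ GenS-spans (Vec.drop 4 Nₛ) countsₛ 7 refl
  , numberOf-containing Kₛ GenS-spans Nₛ countsₛ (# 8) 7 refl
  , numberOf-containing Kₛ GenS-spans Nₛ countsₛ (# 7) 8 refl
  , numberOf-containing Kₛ GenS-spans Nₛ countsₛ (# 6) 9 refl
  , numberOf-containing Kₛ GenS-spans Nₛ countsₛ (# 5) 10 refl
  , numberOf-containing Kₛ GenS-spans Nₛ countsₛ (# 4) 11 refl
  , dimension-range Kₘ GenM-spans (Vec.drop 4 Nₘ) countsₘ 8 refl
  , numberOf-containing Kₘ GenM-spans Nₘ countsₘ (# 7) 8 refl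
  , numberOf-containing Kₘ GenM-spans Nₘ countsₘ (# 6) 9 refl
  , numberOf-containing Kₘ GenM-spans Nₘ countsₘ (# 5) 10 refl
  , numberOf-containing Kₘ GenM-spans Nₘ countsₘ (# 4) 11 refl
  , numberOf-forget stronglyMagic-hasDim (numberOf-containing Kₛₘ GenSM-spans Nₛₘ countsₛₘ (# 4) 11 refl)
  , stronglyMagic-hasDim
  , λ S k S∈ S-dim _ _ n →
      let S-quad = [ proj₁ , [ proj₁ , proj₁ ]′ ]′ S∈
      in mk⇔ (realizable⇒≤ S-dim) (≤⇒realizable S-quad S-dim)
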